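{- Let $G$ be a countable group acting on $\mathcal W$ by negligibility-preserving self-homeomorphisms, and let $\mathcal K$ be a finite set of tiles of $\mathcal W$ which yields a grid for the action of $G$ on $\mathcal W$. Then the map $\Psi_{\mathcal K}$ is a bijection from the set of $\equiv_\lambda$-classes of poly-$\mathcal K$ tiles of $\mathcal W$ onto the set of finite tiles (nonempty finite subsets) of $G\times\mathcal K$; hence, applied elementwise ($\Psi_{\mathcal K}(\mathcal T)=\{\Psi_{\mathcal K}(T) : T\in\mathcal T\}$), it is a bijection from the collection of sets $\mathcal T$ of ($\equiv_\lambda$-classes of) poly-$\mathcal K$ tiles of $\mathcal W$ onto the collection of sets of finite tiles of $G\times\mathcal K$. Moreover, for every such $\mathcal T$, the cotilers of $\mathcal T$ in $\mathcal W$ and those of $\Psi_{\mathcal K}(\mathcal T)$ in $G\times\mathcal K$ are the same up to renaming each $T$ into $\Psi_{\mathcal K}(T)$: a countable set $C\subset G\times\mathcal T$ is a cotiler for $\mathcal T$ if and only if $\{(g,\Psi_{\mathcal K}(T)) : (g,T)\in C\}$ is a cotiler for $\Psi_{\mathcal K}(\mathcal T)$.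
   Context: $\mathcal W$ is a topological space with a nontrivial Borel measure $\lambda$. A group $G$ acts on $\mathcal W$ by self-homeomorphisms that are negligibility-preserving: $\lambda(A)>0\implies\lambda(g\cdot A)>0$ for all $g\in G$. The relation $\equiv_\lambda$ is equality up to $\lambda$-negligible sets, and $\bigsqcup$ denotes a union that is disjoint up to $\lambda$-negligible sets (i.e. sets with distinct indices have $\lambda$-negligible intersection). A tile is a positive-measure subset of $\mathcal W$. A cotiler for a set $\mathcal T$ of tiles is a countable subset $C\subset G\times\mathcal T$ such that $\bigsqcup_{(g,T)\in C} g\cdot T\equiv_\lambda\mathcal W$. A finite set $\mathcal K$ of tiles yields a grid (for $G$ countable) if $G\times\mathcal K$ is a cotiler for $\mathcal K$, that is $\mathcal W\equiv_\lambda\bigsqcup_{(h,K)\in G\times\mathcal K}h\cdot K$. A tile $T$ is a poly-$\mathcal K$ if there is a finite set $\Psi_{\mathcal K}(T)\subset G\times\mathcal K$ with $T\equiv_\lambda\bigsqcup_{(h,K)\in\Psi_{\mathcal K}(T)}h\cdot K$. The same notions (tile, cotiler) are used on the space $G\times\mathcal K$ with discrete topology, counting measure and action $g\cdot(h,K)=(gh,K)$; there, negligible means empty, a tile is a nonempty subset, and the covering in the definition of a cotiler is an exact partition. -}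

module Defs where

open import Algebra.Bundles using (Group)
open import Algebra.Definitions.RawMonoid using (sum)
open import Data.Fin.Base using (Fin; toℕ)
open import Data.List.Base using (List)
import Data.List.Membership.Setoid as Membership
import Data.List.Relation.Binary.Subset.Setoid as Subset
open import Data.Nat.Base using (ℕ)
open import Data.Product.Base using (Σ; ∃; _×_; _,_; proj₁; proj₂; map₂)
open import Data.Product.Relation.Binary.Pointwise.NonDependent using (Pointwise; ×-setoid)
open import Data.Rational.Base using (ℚ; 0ℚ; _<_) renaming (+-0-rawMonoid to ℚ-rawMonoid)
import Data.Rational.Properties as ℚ
open import Data.Unit.Polymorphic.Base using (⊤)
open import Function.Base using (_∘_; _on_)
open import Function.Bundles using (_↣_)
open import Function.Definitions using (Injective; Inverseᵇ)
open import Level using (Level; _⊔_; suc; 0ℓ)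
open import Relation.Binary.Bundles using (Setoid)
import Relation.Binary.Construct.On as On
open import Relation.Binary.Core using (Rel)
open import Relation.Binary.Definitions using (_Respects_; Transitive)
open import Relation.Binary.PropositionalEquality using (_≡_; _≢_; setoid)
open import Relation.Nullary.Negation using (¬_)
open import Relation.Unary using (Pred; _∈_; _⊆_; _≐_; _∩_; _∪_; ∁; ⋃; _⊢_; Empty; Satisfiable)

Whole : ∀ {a ℓ} {A : Set a} → Pred A ℓ
Whole _ = ⊤

-- x ∈ [0,∞] is given by its open lower cut { q ∈ ℚ | q < x }; the cut of ∞ is
-- all of ℚ.
record [0,∞] : Set₁ where
  field
    Below    : Pred ℚ 0ℓ
    negative : ∀ {q} → q < 0ℚ → Below q
    lower    : ∀ {p q} → p < q → Below q → Below p
    rounded  : ∀ {p} → Below p → ∃ λ q → p < q × Below q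

open [0,∞] public using (Below)

infix 4 _≈∞_

_≈∞_ : Rel [0,∞] 0ℓ
x ≈∞ y = Below x ≐ Below y

0∞ : [0,∞]
0∞ = record
  { Below    = _< 0ℚ
  ; negative = λ q<0 → q<0
  ; lower    = ℚ.<-trans
  ; rounded  = ℚ.<-dense
  }

Positive : Pred [0,∞] 0ℓ
Positive x = Below x 0ℚ

-- The supremum of the partial sums: q < ∑ x iff q < r₀ + ⋯ + r₍ₙ₋₁₎ for some n and
-- some rationals rᵢ < xᵢ.
∑ : (ℕ → [0,∞]) → [0,∞]
∑ x = record
  { Below    = λ q → ∃ λ n → Σ (Fin n → ℚ) λ r →
                 (∀ i → Below (x (toℕ i)) (r i)) × q < sum ℚ-rawMonoid r
  ; negative = λ q<0 → 0 , (λ ()) , (λ ()) , q<0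
  ; lower    = λ { p<q (n , r , r<x , q<∑r) → n , r , r<x , ℚ.<-trans p<q q<∑r }
  ; rounded  = λ { (n , r , r<x , p<∑r) → let (q , p<q , q<∑r) = ℚ.<-dense p<∑r in
                   q , p<q , n , r , r<x , q<∑r }
  }

-- A subset of the quotient A / ≈, as a saturated predicate on representatives.
record ClassSet {a r} {A : Set a} (_≈_ : Rel A r) (p : Level) : Set (a ⊔ r ⊔ suc p) where
  field
    Member   : Pred A p
    respects : Member Respects _≈_

open ClassSet public using (Member)

_≐ᶜ_ : ∀ {a r p} {A : Set a} {_≈_ : Rel A r} → Rel (ClassSet _≈_ p) (a ⊔ p)
𝒮 ≐ᶜ 𝒯 = Member 𝒮 ≐ Member 𝒯

-- { f x | x ∈ 𝒮 }
image : ∀ {a b r s p} {A : Set a} {B : Set b} {_≈₁_ : Rel A r} {_≈₂_ : Rel B s} →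
        Transitive _≈₂_ → (A → B) → ClassSet _≈₁_ p → ClassSet _≈₂_ (a ⊔ s ⊔ p)
image {_≈₂_ = _≈₂_} ≈₂-trans f 𝒮 = record
  { Member   = λ y → ∃ λ x → Member 𝒮 x × (f x ≈₂ y)
  ; respects = λ { y≈z (x , x∈𝒮 , fx≈y) → x , x∈𝒮 , ≈₂-trans fx≈y y≈z }
  }

-- Countability (finite and empty included) of the set of ≈-classes meeting C, by
-- a system of representatives with exactly one element elt i ∈ C in each class.
record Countable {a r p} (i : Level) {A : Set a} (_≈_ : Rel A r) (C : Pred A p) :
                 Set (a ⊔ r ⊔ p ⊔ suc i) where
  field
    Index    : Set i
    code     : Index ↣ ℕ
    elt      : Index → A
    elt∈     : ∀ j → elt j ∈ C
    distinct : Injective _≡_ _≈_ elt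
    exhaust  : ∀ {x} → x ∈ C → ∃ λ j → elt j ≈ x

module UpTo {ℓ ν} {X : Set ℓ} (Negligible : Pred (Pred X ℓ) ν) where

  infix 4 _≡ⁿ_ _≡⨆[_]_

  _≡ⁿ_ : Rel (Pred X ℓ) ν
  A ≡ⁿ B = Negligible ((A ∩ ∁ B) ∪ (∁ A ∩ B))

  -- B ≡⨆[ I ] A : B is the union of the A i, disjoint up to negligible sets.
  _≡⨆[_]_ : Pred X ℓ → (I : Setoid ℓ ℓ) → (Setoid.Carrier I → Pred X ℓ) → Set (ℓ ⊔ ν)
  B ≡⨆[ I ] A = (∀ i j → ¬ (i ≈ j) → Negligible (A i ∩ A j)) × B ≡ⁿ ⋃ Carrier A
    where open Setoid I

record Action {ℓ} (G : Group ℓ ℓ) (X : Setoid ℓ ℓ) : Set ℓ where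
  private
    module G = Group G
    module X = Setoid X
  infixr 6 _▷_
  field
    _▷_      : G.Carrier → X.Carrier → X.Carrier
    ▷-cong   : ∀ {g h x y} → g G.≈ h → x X.≈ y → g ▷ x X.≈ h ▷ y
    identity : ∀ x → G.ε ▷ x X.≈ x
    assoc    : ∀ g h x → (g G.∙ h) ▷ x X.≈ g ▷ (h ▷ x)

  infixr 6 _·_

  _·_ : G.Carrier → Pred X.Carrier ℓ → Pred X.Carrier ℓ
  (g · A) x = ∃ λ y → y ∈ A × g ▷ y X.≈ x

-- A set of tiles is a predicate on a type T of (representatives of) tiles, where
-- ⟦ t ⟧ is the subset of X underlying t : T and ≈ identifies equal tiles.
module _ {ℓ ν} {G : Group ℓ ℓ} {X : Setoid ℓ ℓ} (α : Action G X)
         (Negligible : Pred (Pred (Setoid.Carrier X) ℓ) ν)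
         {t r} {T : Set t} (_≈_ : Rel T r) (⟦_⟧ : T → Pred (Setoid.Carrier X) ℓ) where

  private
    module G = Group G
  open Action α
  open UpTo Negligible

  -- The union is over one representative of each class in C: when ≈ is equality
  -- up to negligible sets, a class has too many representatives to take the union
  -- of all of them.  Since C is countable, a different choice of
  -- representatives changes the union by a negligible set only.
  record IsCotiler {p q} (𝒯 : Pred T p) (C : Pred (G.Carrier × T) q) :
                   Set (ν ⊔ t ⊔ r ⊔ p ⊔ q ⊔ suc ℓ) where
    field
      subset    : C ⊆ (proj₂ ⊢ 𝒯)
      countable : Countable ℓ (Pointwise G._≈_ _≈_) C
    open Countable countable
    field
      covers    : Whole ≡⨆[ setoid Index ] λ i → proj₁ (elt i) · ⟦ proj₂ (elt i) ⟧

record Topology {ℓ} (X : Setoid ℓ ℓ) : Set (suc (suc ℓ)) where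
  open Setoid X
  field
    IsOpen   : Pred (Pred Carrier ℓ) (suc ℓ)
    respects : ∀ {A} → IsOpen A → A Respects _≈_
    whole    : IsOpen Whole
    meet     : ∀ {A B} → IsOpen A → IsOpen B → IsOpen (A ∩ B)
    -- ⋃𝒜 lives in a higher universe, hence the detour via B.
    union    : ∀ (𝒜 : Pred (Pred Carrier ℓ) (suc ℓ)) → 𝒜 ⊆ IsOpen →
               ∀ {B : Pred Carrier ℓ} → B ≐ (λ x → ∃ λ A → A ∈ 𝒜 × x ∈ A) → IsOpen B

module _ {ℓ} {X : Setoid ℓ ℓ} (τ : Topology X) where
  open Setoid X
  open Topology τ

  Continuous : Pred (Carrier → Carrier) (suc ℓ)
  Continuous f = ∀ {A} → IsOpen A → IsOpen (f ⊢ A)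

  IsHomeomorphism : Pred (Carrier → Carrier) (suc ℓ)
  IsHomeomorphism f = Continuous f × ∃ λ f⁻¹ → Continuous f⁻¹ × Inverseᵇ _≈_ _≈_ f f⁻¹

  data Borel : Pred (Pred Carrier ℓ) (suc ℓ) where
    open-set   : ∀ {A} → IsOpen A → Borel A
    complement : ∀ {A} → Borel A → Borel (∁ A)
    ⋃-borel    : ∀ {A : ℕ → Pred Carrier ℓ} → (∀ n → Borel (A n)) → Borel (⋃ ℕ A)
    resp-≐     : ∀ {A B} → A ≐ B → Borel A → Borel B

  BorelSet : Set (suc ℓ)
  BorelSet = Σ (Pred Carrier ℓ) Borel

  record BorelMeasure : Set (suc (suc ℓ)) where
    field
      measure    : BorelSet → [0,∞]
      cong       : ∀ {A B} → proj₁ A ≐ proj₁ B → measure A ≈∞ measure B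
      empty      : ∀ {A} → Empty (proj₁ A) → measure A ≈∞ 0∞
      σ-additive : ∀ (A : ℕ → BorelSet) →
                   (∀ m n → m ≢ n → Empty (proj₁ (A m) ∩ proj₁ (A n))) →
                   measure (⋃ ℕ (proj₁ ∘ A) , ⋃-borel (proj₂ ∘ A)) ≈∞ ∑ (measure ∘ A)

  Borel-respects : ∀ {A} → Borel A → A Respects _≈_
  Borel-respects (open-set A-open) = respects A-open
  Borel-respects (complement A-borel) x≈y x∉A y∈A =
    x∉A (Borel-respects A-borel (sym x≈y) y∈A)
  Borel-respects (⋃-borel A-borel) x≈y (n , x∈An) = n , Borel-respects (A-borel n) x≈y x∈An
  Borel-respects (resp-≐ (A⊆B , B⊆A) A-borel) x≈y x∈B =
    A⊆B (Borel-respects A-borel x≈y (B⊆A x∈B))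

  Borel-preimage : ∀ {f} → Continuous f → ∀ {A} → Borel A → Borel (f ⊢ A)
  Borel-preimage f-cont (open-set A-open) = open-set (f-cont A-open)
  Borel-preimage f-cont (complement A-borel) = complement (Borel-preimage f-cont A-borel)
  Borel-preimage f-cont (⋃-borel A-borel) = ⋃-borel λ n → Borel-preimage f-cont (A-borel n)
  Borel-preimage f-cont (resp-≐ (A⊆B , B⊆A) A-borel) =
    resp-≐ (A⊆B , B⊆A) (Borel-preimage f-cont A-borel)

  Borel-image : ∀ {f} → IsHomeomorphism f → ∀ {A} → Borel A →
                Borel (λ x → ∃ λ y → y ∈ A × f y ≈ x)
  Borel-image (_ , f⁻¹ , f⁻¹-cont , invˡ , invʳ) A-borel = resp-≐
    ( (λ {x} x∈ → f⁻¹ x , x∈ , invˡ refl)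
    , λ { (y , y∈A , fy≈x) → Borel-respects A-borel (sym (invʳ (sym fy≈x))) y∈A } )
    (Borel-preimage f⁻¹-cont A-borel)

module _ {ℓ} {X : Setoid ℓ ℓ} {τ : Topology X} (μ : BorelMeasure τ) where
  open Setoid X using (Carrier)
  open BorelMeasure μ

  Nontrivial : Set
  Nontrivial = Positive (measure (Whole , open-set (Topology.whole τ)))

  Null : Pred (Pred Carrier ℓ) (suc ℓ)
  Null A = Σ (BorelSet τ) λ N → A ⊆ proj₁ N × measure N ≈∞ 0∞

  record Tile : Set (suc ℓ) where
    field
      borelSet : BorelSet τ
      positive : Positive (measure borelSet)

    set : Pred Carrier ℓ
    set = proj₁ borelSet

  module _ {G : Group ℓ ℓ} (α : Action G X) where
    open Action α

    ByHomeomorphisms : Set (suc ℓ)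
    ByHomeomorphisms = ∀ g → IsHomeomorphism τ (g ▷_)

    NegligibilityPreserving : ByHomeomorphisms → Set (suc ℓ)
    NegligibilityPreserving homeo = ∀ g (A : BorelSet τ) → Positive (measure A) →
      Positive (measure (g · proj₁ A , Borel-image τ (homeo g) (proj₂ A)))

-- The members of 𝒦 are named by Fin n.
module Poly {ℓ} {G : Group ℓ ℓ} {W : Setoid ℓ ℓ} {τ : Topology W} (μ : BorelMeasure τ)
            (α : Action G W) {n : ℕ} (𝒦 : Fin n → Tile μ) where

  private
    module G = Group G
    module W = Setoid W
  open Action α
  open UpTo (Null μ)

  G×𝒦 : Setoid ℓ ℓ
  G×𝒦 = ×-setoid G.setoid (setoid (Fin n))

  open Setoid G×𝒦 public using () renaming (Carrier to Cell)
  open Membership G×𝒦 using () renaming (_∈_ to _∈ˡ_)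
  open Subset G×𝒦 using () renaming (_⊆_ to _⊆ˡ_)

  cell : Cell → Pred W.Carrier ℓ
  cell (h , k) = h · Tile.set (𝒦 k)

  YieldsGrid : Set (suc ℓ)
  YieldsGrid = Whole ≡⨆[ G×𝒦 ] cell

  -- Finite subsets of G × 𝒦 are lists, identified when they have the same elements.
  elements : List Cell → Pred Cell ℓ
  elements cs = _∈ˡ cs

  subsetoid : List Cell → Setoid ℓ ℓ
  subsetoid cs = On.setoid {B = Σ Cell (elements cs)} G×𝒦 proj₁

  -- A poly-𝒦 tile together with a choice of the finite set Ψ.  Ψ may a priori
  -- depend on this choice: its being a function of the class of the tile is part of
  -- it being congruent for ≈ᵖ, which ignores the choice.
  record PolyTile : Set (suc ℓ) where
    field
      tile      : Tile μ
      Ψ         : List Cell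
      decompose : Tile.set tile ≡⨆[ subsetoid Ψ ] (cell ∘ proj₁)

    set : Pred W.Carrier ℓ
    set = Tile.set tile

  open PolyTile public using (Ψ)

  _≈ᵖ_ : Rel PolyTile (suc ℓ)
  _≈ᵖ_ = _≡ⁿ_ on PolyTile.set

  FiniteTile : Set ℓ
  FiniteTile = Σ (List Cell) (Satisfiable ∘ elements)

  _≈ᶠ_ : Rel FiniteTile ℓ
  (cs , _) ≈ᶠ (ds , _) = cs ⊆ˡ ds × ds ⊆ˡ cs

  ≈ᶠ-trans : Transitive _≈ᶠ_
  ≈ᶠ-trans (c⊆d , d⊆c) (d⊆e , e⊆d) = (λ x∈ → d⊆e (c⊆d x∈)) , (λ x∈ → d⊆c (e⊆d x∈))

  _≈ᵍᶠ_ : Rel (G.Carrier × FiniteTile) ℓ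
  _≈ᵍᶠ_ = Pointwise G._≈_ _≈ᶠ_

  ≈ᵍᶠ-trans : Transitive _≈ᵍᶠ_
  ≈ᵍᶠ-trans {_ , F} {_ , F′} {_ , F″} (g≈ , F≈) (g′≈ , F′≈) =
    G.trans g≈ g′≈ , ≈ᶠ-trans {F} {F′} {F″} F≈ F′≈

  translation : Action G G×𝒦
  translation = record
    { _▷_      = λ { g (h , k) → g G.∙ h , k }
    ; ▷-cong   = λ { g≈g′ (h≈h′ , k≡k′) → G.∙-cong g≈g′ h≈h′ , k≡k′ }
    ; identity = λ { (h , k) → G.identityˡ h , _≡_.refl }
    ; assoc    = λ { g g′ (h , k) → G.assoc g g′ h , _≡_.refl }
    }

  PolyTileSet : Set (suc (suc ℓ))
  PolyTileSet = ClassSet _≈ᵖ_ (suc ℓ)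

  FiniteTileSet : Set (suc (suc ℓ))
  FiniteTileSet = ClassSet _≈ᶠ_ (suc ℓ)

  -- Subsets of G × { poly-𝒦 tiles up to ≈ᵖ }
  PolyPairSet : Set (suc (suc ℓ))
  PolyPairSet = ClassSet (Pointwise G._≈_ _≈ᵖ_) (suc ℓ)

  FinitePairSet : Set (suc (suc ℓ))
  FinitePairSet = ClassSet _≈ᵍᶠ_ (suc ℓ)

  IsCotilerᵂ : PolyTileSet → PolyPairSet → Set (suc ℓ)
  IsCotilerᵂ 𝒯 C = IsCotiler α (Null μ) _≈ᵖ_ PolyTile.set (Member 𝒯) (Member C)

  -- Only the empty set is negligible for the counting measure.
  IsCotilerᴳ : FiniteTileSet → FinitePairSet → Set (suc ℓ)
  IsCotilerᴳ ℱ D =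
    IsCotiler translation Empty _≈ᶠ_ (elements ∘ proj₁) (Member ℱ) (Member D)

  module _ (Ψ-nonempty : ∀ T → Satisfiable (elements (Ψ T))) where

    Ψᶠ : PolyTile → FiniteTile
    Ψᶠ T = Ψ T , Ψ-nonempty T

    Ψ-set : PolyTileSet → FiniteTileSet
    Ψ-set = image (λ {F} {F′} {F″} → ≈ᶠ-trans {F} {F′} {F″}) Ψᶠ

    -- { (g , Ψ T) | (g , T) ∈ C }
    rename : PolyPairSet → FinitePairSet
    rename = image (λ {x} {y} {z} → ≈ᵍᶠ-trans {x} {y} {z}) (map₂ Ψᶠ)

{-# OPTIONS --safe #-}
module Submission where

-- Null sets form a σ-ideal, and translates of null sets are null.  Every grid cell
-- has positive measure while distinct cells have null intersection, so a cell is
-- contained up to a null set in a union of cells (over a subset S of G × 𝒦, which is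
-- countable) only if it is one of them.  Hence S ↦ region S, the union of the cells
-- in S, turns disjointness and covering in G × 𝒦 into disjointness and covering up to
-- null sets in W and back.  A poly-𝒦 tile T is region (Ψ T) up to a null set, so Ψ T
-- and the class of T determine each other, and g · T is likewise region (g · Ψ T); this
-- transfers cotilers in both directions.

open import Defs
open import Algebra.Bundles using (Group)
open import Algebra.Definitions.RawMonoid using (sum)
open import Axiom.ExcludedMiddle using (ExcludedMiddle)
open import Data.Fin.Base using (Fin; toℕ)
import Data.Fin.Properties as Fin
open import Data.List.Base using ([]; _∷_)
open import Data.List.Membership.Setoid.Properties using (∈-resp-≈)
open import Data.List.Relation.Unary.Any using (here; there)
open import Data.Nat.Base as ℕ using (ℕ; zero; suc)
open import Data.Nat.Induction using (<-rec)
import Data.Nat.Properties as ℕ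
open import Data.Product.Base using (Σ; ∃; _×_; _,_; proj₁; proj₂; map₂)
open import Data.Product.Relation.Binary.Pointwise.NonDependent using (Pointwise)
open import Data.Rational.Base as ℚ using (ℚ; 0ℚ) renaming (+-0-rawMonoid to ℚ-rawMonoid)
import Data.Rational.Properties as ℚ
open import Data.Sum.Base using (inj₁; inj₂; [_,_]′)
open import Function.Base using (_∘_; id)
open import Function.Bundles using (_⇔_; mk⇔; Equivalence; _↣_; mk↣; Injection)
open import Function.Definitions using (Injective)
open import Function.Structures using (IsBijection)
open import Level using (Level; _⊔_)
open import Relation.Binary.Bundles using (Setoid)
import Relation.Binary.Construct.On as On
open import Relation.Binary.Core using (Rel)
open import Relation.Binary.Definitions using (_Respects_; Transitive; tri<; tri≈; tri>)
open import Relation.Binary.PropositionalEquality as ≡ using (_≡_; _≢_; refl; setoid)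
open import Relation.Binary.Structures using (IsEquivalence)
open import Relation.Nullary.Decidable using (Dec; yes; no; decidable-stable)
open import Relation.Nullary.Negation using (¬_; contradiction)
open import Relation.Unary
  using (Pred; U; Satisfiable; Empty; _∈_; _∉_; _≐_; _⊆_; _⊢_; _∩_; _∪_; ∁; ⋃)
open import Relation.Unary.Polymorphic using (∅)

-- Zero, positive values and series in `[0,∞]`.

pair : ∀ {a} {A : Set a} → A → A → ℕ → A
pair x y zero    = x
pair x y (suc _) = y

-- Cuts are closed downwards and contain every negative rational, so a cut that misses 0 is the cut
-- of 0.
¬positive⇒≈0 : ∀ x → ¬ Positive x → x ≈∞ 0∞
¬positive⇒≈0 x ¬pos = below⇒negative , [0,∞].negative x
  where
  below⇒negative : ∀ {q} → Below x q → q ℚ.< 0ℚ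
  below⇒negative {q} q<x with ℚ.<-cmp q 0ℚ
  ... | tri< q<0 _ _  = q<0
  ... | tri≈ _ refl _ = contradiction q<x ¬pos
  ... | tri> _ _ 0<q  = contradiction ([0,∞].lower x 0<q q<x) ¬pos

≈0⇒¬positive : ∀ x → x ≈∞ 0∞ → ¬ Positive x
≈0⇒¬positive x (x⊆0 , _) pos = ℚ.<-irrefl refl (x⊆0 pos)

sum≤0 : ∀ {n} (r : Fin n → ℚ) → (∀ i → r i ℚ.≤ 0ℚ) → sum ℚ-rawMonoid r ℚ.≤ 0ℚ
sum≤0 {zero}  r r≤0 = ℚ.≤-refl
sum≤0 {suc n} r r≤0 = ℚ.+-mono-≤ (r≤0 Fin.zero) (sum≤0 (r ∘ Fin.suc) (r≤0 ∘ Fin.suc))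

-- Rationals below terms equal to 0 are negative, so no partial sum exceeds 0.
∑≈0 : ∀ x → (∀ n → x n ≈∞ 0∞) → ∑ x ≈∞ 0∞
∑≈0 x x≈0 = ¬positive⇒≈0 (∑ x) λ { (n , r , r<x , 0<∑r) →
  ℚ.<-irrefl refl (ℚ.<-≤-trans 0<∑r (sum≤0 r λ i → ℚ.<⇒≤ (proj₁ (x≈0 (toℕ i)) (r<x i)))) }

∑-positive : ∀ x → Positive (x 0) → Positive (∑ x)
∑-positive x pos =
  -- Roundedness yields a rational `q` strictly between 0 and `x 0`; the one-term partial sum is
  -- `q + 0`.
  let (q , 0<q , q<x₀) = [0,∞].rounded (x 0) pos in
  1 , (λ _ → q) , (λ { Fin.zero → q<x₀ }) , ≡.subst (0ℚ ℚ.<_) (≡.sym (ℚ.+-identityʳ q)) 0<q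

module Classical (em : ∀ {a} → ExcludedMiddle a) where

  dne : ∀ {a} {P : Set a} → ¬ ¬ P → P
  dne = decidable-stable em

  -- Borel sets and disjoint sequences.

  module _ {ℓ} {X : Setoid ℓ ℓ} {τ : Topology X} where
    open Setoid X using (Carrier)

    borel-∅ : Borel τ ∅
    borel-∅ = resp-≐ (contradiction _ , λ ()) (complement (open-set (Topology.whole τ)))

    -- Closure under unions is given for sequences, so `B` is repeated in every later place.
    borel-∪ : ∀ {A B} → Borel τ A → Borel τ B → Borel τ (A ∪ B)
    borel-∪ {A} {B} A-borel B-borel = resp-≐
      ((λ { (zero , x∈A) → inj₁ x∈A ; (suc _ , x∈B) → inj₂ x∈B }) ,
       λ { (inj₁ x∈A) → 0 , x∈A ; (inj₂ x∈B) → 1 , x∈B })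
      (⋃-borel {A = pair A B} λ { zero → A-borel ; (suc _) → B-borel })

    borel-∖ : ∀ {A B} → Borel τ A → Borel τ B → Borel τ (A ∩ ∁ B)
    borel-∖ A-borel B-borel = resp-≐
      ((λ x∉ → dne (x∉ ∘ inj₁) , x∉ ∘ inj₂) ,
       λ { (x∈A , x∉B) → [ (λ x∉A → x∉A x∈A) , x∉B ]′ })
      (complement (borel-∪ (complement A-borel) B-borel))

    module _ (A : ℕ → BorelSet τ) where

      -- The condition `m < n` is moved into the sets of a union over all of `ℕ`, so that `⋃-borel`
      -- applies.
      earlier : ℕ → Pred Carrier ℓ
      earlier n = ⋃ ℕ λ m x → m ℕ.< n × x ∈ proj₁ (A m)

      borel-earlier : ∀ n → Borel τ (earlier n)
      borel-earlier n = ⋃-borel λ m → borel-at m (m ℕ.<? n)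
        where
        borel-at : ∀ m → Dec (m ℕ.< n) → Borel τ (λ x → m ℕ.< n × x ∈ proj₁ (A m))
        borel-at m (yes m<n) = resp-≐ ((m<n ,_) , proj₂) (proj₂ (A m))
        borel-at m (no m≮n)  = resp-≐ ((λ ()) , λ (m<n , _) → contradiction m<n m≮n) borel-∅

      -- `σ-additive` asks for exactly disjoint sets; these pieces provide them without changing the
      -- union.
      disjointify : ℕ → BorelSet τ
      disjointify n =
        proj₁ (A n) ∩ ∁ (earlier n) , borel-∖ (proj₂ (A n)) (borel-earlier n)

      disjointify-disjoint : ∀ m n → m ≢ n →
                             Empty (proj₁ (disjointify m) ∩ proj₁ (disjointify n))
      disjointify-disjoint m n m≢n x ((x∈Aₘ , x∉m) , (x∈Aₙ , x∉n)) with ℕ.<-cmp m n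
      ... | tri< m<n _ _ = x∉n (m , m<n , x∈Aₘ)
      ... | tri≈ _ m≡n _ = m≢n m≡n
      ... | tri> _ _ n<m = x∉m (n , n<m , x∈Aₙ)

      -- A point belongs to the piece of the least index whose set contains it; strong induction
      -- descends to that index.
      ⋃-disjointify : ⋃ ℕ (proj₁ ∘ disjointify) ≐ ⋃ ℕ (proj₁ ∘ A)
      ⋃-disjointify = map₂ proj₁ , λ { {x} (n , x∈Aₙ) → <-rec (P x) (first x) n x∈Aₙ }
        where
        P : Carrier → ℕ → Set ℓ
        P x n = x ∈ proj₁ (A n) → x ∈ ⋃ ℕ (proj₁ ∘ disjointify)
        first : ∀ x n → (∀ {m} → m ℕ.< n → P x m) → P x n
        first x n rec x∈Aₙ with em {P = x ∈ earlier n}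
        ... | yes (m , m<n , x∈Aₘ) = rec m<n x∈Aₘ
        ... | no x∉                = n , x∈Aₙ , x∉

  -- The σ-ideal of null sets.

  module NullIdeal {ℓ} {X : Setoid ℓ ℓ} {τ : Topology X} (μ : BorelMeasure τ) where
    open Setoid X using (Carrier)
    open BorelMeasure μ
    open UpTo (Null μ)

    ⋃ᵇ : (ℕ → BorelSet τ) → BorelSet τ
    ⋃ᵇ A = ⋃ ℕ (proj₁ ∘ A) , ⋃-borel (proj₂ ∘ A)

    measure-⋃ : ∀ A → measure (⋃ᵇ A) ≈∞ ∑ (measure ∘ disjointify A)
    measure-⋃ A =
      let (⋃⊆∑ , ∑⊆⋃) = σ-additive (disjointify A) (disjointify-disjoint A)
          (A⊆D , D⊆A) = cong {⋃ᵇ A} {⋃ᵇ (disjointify A)}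
                          (proj₂ (⋃-disjointify A) , proj₁ (⋃-disjointify A))
      in ⋃⊆∑ ∘ A⊆D , D⊆A ∘ ∑⊆⋃

    -- The sequence `A, B, B, …` has union `B`, and nothing precedes `A`, so the measure of `A` is
    -- the first term of the series for `B`.
    positive-mono : ∀ {A B : BorelSet τ} → proj₁ A ⊆ proj₁ B →
                    Positive (measure A) → Positive (measure B)
    positive-mono {A} {B} A⊆B A-pos =
      proj₁ (cong {⋃ᵇ S} {B} ((λ { (zero , x∈A) → A⊆B x∈A ; (suc _ , x∈B) → x∈B }) , (1 ,_)))
        (proj₂ (measure-⋃ S) (∑-positive (measure ∘ disjointify S)
          (proj₁ (cong {A} {disjointify S 0} ((_, λ { (_ , () , _) }) , proj₁)) A-pos)))
      where
      S = pair A B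

    null-⊆ : ∀ {A B} → A ⊆ B → Null μ B → Null μ A
    null-⊆ A⊆B (N , B⊆N , N≈0) = N , (λ x∈A → B⊆N (A⊆B x∈A)) , N≈0

    null-∅ : Null μ ∅
    null-∅ = (∅ , borel-∅) , (λ ()) , empty λ _ ()

    null-empty : ∀ {A} → (∀ {x} → x ∉ A) → Null μ A
    null-empty x∉A = null-⊆ (λ x∈A → contradiction x∈A x∉A) null-∅

    -- The disjoint pieces of the Borel null hulls lie in those hulls, so every term of the series
    -- vanishes.
    null-⋃ : ∀ {A} → (∀ n → Null μ (A n)) → Null μ (⋃ ℕ A)
    null-⋃ {A} A-null = ⋃ᵇ N , map₂ (proj₁ (proj₂ (A-null _))) ,
      ¬positive⇒≈0 (measure (⋃ᵇ N))
        (≈0⇒¬positive (∑ D) (∑≈0 D D≈0) ∘ proj₁ (measure-⋃ N))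
      where
      N = proj₁ ∘ A-null
      D = measure ∘ disjointify N
      D≈0 : ∀ n → D n ≈∞ 0∞
      D≈0 n = ¬positive⇒≈0 (D n) λ pos →
        ≈0⇒¬positive (measure (N n)) (proj₂ (proj₂ (A-null n)))
          (positive-mono {disjointify N n} {N n} proj₁ pos)

    null-∪ : ∀ {A B} → Null μ A → Null μ B → Null μ (A ∪ B)
    null-∪ {A} {B} A-null B-null = null-⊆
      (λ { (inj₁ x∈A) → 0 , x∈A ; (inj₂ x∈B) → 1 , x∈B })
      (null-⋃ {pair A B} λ { zero → A-null ; (suc _) → B-null })

    -- The family is spread over `ℕ` along the code, with the empty set at numbers that code no
    -- index.
    null-cover : ∀ {i} {I : Set i} → I ↣ ℕ → ∀ {A : I → Pred Carrier ℓ} {B} →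
                 (∀ {x} → x ∈ B → ∃ λ j → x ∈ A j) → (∀ j → Null μ (A j)) → Null μ B
    null-cover {I = I} code {A} cover A-null = null-⊆
      (λ x∈B → let (j , x∈Aⱼ) = cover x∈B in to j , at-code j em x∈Aⱼ)
      (null-⋃ λ m → at-null {m} em)
      where
      open Injection code using (to; injective)
      at : ∀ {m} → Dec (∃ λ j → to j ≡ m) → Pred Carrier ℓ
      at (yes (j , _)) = A j
      at (no _)        = ∅
      at-null : ∀ {m} (j? : Dec (∃ λ j → to j ≡ m)) → Null μ (at j?)
      at-null (yes (j , _)) = A-null j
      at-null (no _)        = null-∅
      at-code : ∀ j (j? : Dec (∃ λ j′ → to j′ ≡ to j)) → A j ⊆ at j?
      at-code j (yes (j′ , eq)) {x} = ≡.subst (λ k → x ∈ A k) (≡.sym (injective eq))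
      at-code j (no ∄j)             = contradiction (j , refl) ∄j

    positive⇒¬null : (A : BorelSet τ) → Positive (measure A) → ¬ Null μ (proj₁ A)
    positive⇒¬null A A-pos (N , A⊆N , N≈0) =
      ≈0⇒¬positive (measure N) N≈0 (positive-mono {A} {N} A⊆N A-pos)

    ¬null⇒positive : (A : BorelSet τ) → ¬ Null μ (proj₁ A) → Positive (measure A)
    ¬null⇒positive A ¬null = dne λ ¬pos → ¬null (A , id , ¬positive⇒≈0 (measure A) ¬pos)

    -- Inclusion and equality up to null sets.

    infix 4 _⊆ⁿ_

    _⊆ⁿ_ : Rel (Pred Carrier ℓ) (Level.suc ℓ)
    A ⊆ⁿ B = Null μ (A ∩ ∁ B)

    ⊆⇒⊆ⁿ : ∀ {A B} → A ⊆ B → A ⊆ⁿ B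
    ⊆⇒⊆ⁿ A⊆B = null-empty λ { (x∈A , x∉B) → x∉B (A⊆B x∈A) }

    ⊆ⁿ-trans : ∀ {A B C} → A ⊆ⁿ B → B ⊆ⁿ C → A ⊆ⁿ C
    ⊆ⁿ-trans {A} {B} {C} A⊆B B⊆C = null-⊆ split (null-∪ A⊆B B⊆C)
      where
      split : A ∩ ∁ C ⊆ (A ∩ ∁ B) ∪ (B ∩ ∁ C)
      split {x} (x∈A , x∉C) with em {P = x ∈ B}
      ... | yes x∈B = inj₂ (x∈B , x∉C)
      ... | no x∉B  = inj₁ (x∈A , x∉B)

    ⊆ⁿ-∩ : ∀ {A A′ B B′} → A ⊆ⁿ A′ → B ⊆ⁿ B′ → (A ∩ B) ⊆ⁿ (A′ ∩ B′)
    ⊆ⁿ-∩ {A} {A′} {B} {B′} A⊆A′ B⊆B′ = null-⊆ split (null-∪ A⊆A′ B⊆B′)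
      where
      split : (A ∩ B) ∩ ∁ (A′ ∩ B′) ⊆ (A ∩ ∁ A′) ∪ (B ∩ ∁ B′)
      split {x} ((x∈A , x∈B) , x∉) with em {P = x ∈ A′}
      ... | yes x∈A′ = inj₂ (x∈B , λ x∈B′ → x∉ (x∈A′ , x∈B′))
      ... | no x∉A′  = inj₁ (x∈A , x∉A′)

    ⊆ⁿ-⋃ : ∀ {I : Set ℓ} → I ↣ ℕ → ∀ {A B : I → Pred Carrier ℓ} →
           (∀ i → A i ⊆ⁿ B i) → ⋃ I A ⊆ⁿ ⋃ I B
    ⊆ⁿ-⋃ code = null-cover code λ { ((i , x∈Aᵢ) , x∉B) → i , x∈Aᵢ , λ x∈Bᵢ → x∉B (i , x∈Bᵢ) }

    null-⊆ⁿ : ∀ {A B} → A ⊆ⁿ B → Null μ B → Null μ A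
    null-⊆ⁿ {A} {B} A⊆B B-null = null-⊆ split (null-∪ A⊆B B-null)
      where
      split : A ⊆ (A ∩ ∁ B) ∪ B
      split {x} x∈A with em {P = x ∈ B}
      ... | yes x∈B = inj₂ x∈B
      ... | no x∉B  = inj₁ (x∈A , x∉B)

    ≡ⁿ⇒⊆ⁿ : ∀ {A B} → A ≡ⁿ B → A ⊆ⁿ B
    ≡ⁿ⇒⊆ⁿ = null-⊆ inj₁

    ≡ⁿ⇒⊇ⁿ : ∀ {A B} → A ≡ⁿ B → B ⊆ⁿ A
    ≡ⁿ⇒⊇ⁿ = null-⊆ λ { (x∈B , x∉A) → inj₂ (x∉A , x∈B) }

    ⊆ⁿ-antisym : ∀ {A B} → A ⊆ⁿ B → B ⊆ⁿ A → A ≡ⁿ B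
    ⊆ⁿ-antisym A⊆B B⊆A = null-⊆
      (λ { (inj₁ x∈) → inj₁ x∈ ; (inj₂ (x∉A , x∈B)) → inj₂ (x∈B , x∉A) })
      (null-∪ A⊆B B⊆A)

    ≐⇒≡ⁿ : ∀ {A B} → A ≐ B → A ≡ⁿ B
    ≐⇒≡ⁿ (A⊆B , B⊆A) = ⊆ⁿ-antisym (⊆⇒⊆ⁿ A⊆B) (⊆⇒⊆ⁿ B⊆A)

    ≡ⁿ-isEquivalence : IsEquivalence _≡ⁿ_
    ≡ⁿ-isEquivalence = record
      { refl  = ≐⇒≡ⁿ (id , id)
      ; sym   = λ A≡B → ⊆ⁿ-antisym (≡ⁿ⇒⊇ⁿ A≡B) (≡ⁿ⇒⊆ⁿ A≡B)
      ; trans = λ A≡B B≡C → ⊆ⁿ-antisym (⊆ⁿ-trans (≡ⁿ⇒⊆ⁿ A≡B) (≡ⁿ⇒⊆ⁿ B≡C))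
                                        (⊆ⁿ-trans (≡ⁿ⇒⊇ⁿ B≡C) (≡ⁿ⇒⊇ⁿ A≡B))
      }

-- Bijections induced on sets of classes.

image-bijection : ∀ {a b r s} p {A : Set a} {B : Set b} {_≈₁_ : Rel A r} {_≈₂_ : Rel B s}
                  {f : A → B} → IsBijection _≈₁_ _≈₂_ f → (≈₂-trans : Transitive _≈₂_) →
                  IsBijection _≐ᶜ_ _≐ᶜ_ (image {p = a ⊔ s ⊔ p} {_≈₁_ = _≈₁_} ≈₂-trans f)
image-bijection {a} {s = s} p {A} {B} {_≈₁_} {_≈₂_} {f} bij ≈₂-trans = record
  { isInjection = record
    { isCongruent = record
      { cong           = λ { {𝒮} {𝒯} (S⊆T , T⊆S) → image-mono 𝒮 𝒯 S⊆T , image-mono 𝒯 𝒮 T⊆S }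
      ; isEquivalence₁ = ≐ᶜ-isEquivalence
      ; isEquivalence₂ = ≐ᶜ-isEquivalence
      }
    ; injective = λ { {𝒮} {𝒯} (fS⊆fT , fT⊆fS) →
        image-reflects 𝒮 𝒯 fS⊆fT , image-reflects 𝒯 𝒮 fT⊆fS }
    }
  -- The witness is the preimage under `f`; the clause treats every set equal to that preimage.
  ; surjective = λ 𝒯 → preimage 𝒯 , λ { (S⊆f⁻¹T , f⁻¹T⊆S) →
      (λ { (x , x∈S , fx≈y) → ClassSet.respects 𝒯 fx≈y (S⊆f⁻¹T x∈S) }) ,
      (λ {y} y∈T → let (x , fx≈y) = strictlySurjective y in
        x , f⁻¹T⊆S (ClassSet.respects 𝒯 (Eq₂.sym fx≈y) y∈T) , fx≈y) }
  }
  where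
  open IsBijection bij using (cong; injective; strictlySurjective; module Eq₁; module Eq₂)
  -- `image` joins `a` and `s` to the level of its argument; at a level that already absorbs them,
  -- source and target agree.
  q = a ⊔ s ⊔ p

  ≐ᶜ-isEquivalence : ∀ {c t} {C : Set c} {_≈_ : Rel C t} →
                     IsEquivalence (_≐ᶜ_ {p = q} {_≈_ = _≈_})
  ≐ᶜ-isEquivalence = record
    { refl  = id , id
    ; sym   = λ (S⊆T , T⊆S) → T⊆S , S⊆T
    ; trans = λ (S⊆T , T⊆S) (T⊆U , U⊆T) → T⊆U ∘ S⊆T , T⊆S ∘ U⊆T
    }

  image′ : ClassSet _≈₁_ q → ClassSet _≈₂_ q
  image′ = image ≈₂-trans f

  image-mono : ∀ (𝒮 𝒯 : ClassSet _≈₁_ q) → Member 𝒮 ⊆ Member 𝒯 →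
               Member (image′ 𝒮) ⊆ Member (image′ 𝒯)
  image-mono 𝒮 𝒯 S⊆T (x , x∈S , fx≈y) = x , S⊆T x∈S , fx≈y

  -- Injectivity identifies `x` with the member of `𝒯` that shares its value, and `𝒯` is saturated.
  image-reflects : ∀ (𝒮 𝒯 : ClassSet _≈₁_ q) →
                   Member (image′ 𝒮) ⊆ Member (image′ 𝒯) → Member 𝒮 ⊆ Member 𝒯
  image-reflects 𝒮 𝒯 fS⊆fT {x} x∈S =
    let (y , y∈T , fy≈fx) = fS⊆fT (x , x∈S , Eq₂.refl) in
    ClassSet.respects 𝒯 (injective fy≈fx) y∈T

  preimage : ClassSet _≈₂_ q → ClassSet _≈₁_ q
  preimage 𝒯 = record
    { Member   = Member 𝒯 ∘ f
    ; respects = λ x≈y → ClassSet.respects 𝒯 (cong x≈y)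
    }

-- The group action, cells and regions of the grid.

module Grid (em : ∀ {a} → ExcludedMiddle a)
            {ℓ} {G : Group ℓ ℓ} {W : Setoid ℓ ℓ} {τ : Topology W} (μ : BorelMeasure τ)
            (α : Action G W) (homeo : ByHomeomorphisms μ α)
            (preserving : NegligibilityPreserving μ α homeo)
            (G-countable : Countable ℓ (Group._≈_ G) (U {A = Group.Carrier G}))
            {n : ℕ} (𝒦 : Fin n → Tile μ) (grid : Poly.YieldsGrid μ α 𝒦) where

  private
    module G = Group G
    module W = Setoid W
  open Poly μ α 𝒦
  open Classical em
  open NullIdeal μ
  open BorelMeasure μ using (measure)
  open UpTo (Null μ)
  open Action α
  open Action translation using () renaming (_·_ to _·ᵗ_)
  private
    module Cell = Setoid G×𝒦
    module G-countable = Countable G-countable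
    module ∅ᴳ = UpTo (Empty {A = Cell} {ℓ = ℓ})

  -- If the translate of the Borel hull `N` had positive measure, translating back by the inverse of
  -- `g` would give positive measure to a subset of `N`.
  translate-null : ∀ g {A} → Null μ A → Null μ (g · A)
  translate-null g {A} (N , A⊆N , N≈0) =
    gN , (λ (y , y∈A , gy≈x) → y , A⊆N y∈A , gy≈x) , ¬positive⇒≈0 (measure gN) λ gN-pos →
    ≈0⇒¬positive (measure N) N≈0 (positive-mono {B = N} g⁻¹gN⊆N (preserving (g G.⁻¹) gN gN-pos))
    where
    gN : BorelSet τ
    gN = g · proj₁ N , Borel-image τ (homeo g) (proj₂ N)
    g⁻¹gN⊆N : (g G.⁻¹) · (g · proj₁ N) ⊆ proj₁ N
    g⁻¹gN⊆N {x} (y , (z , z∈N , gz≈y) , g⁻¹y≈x) = Borel-respects τ (proj₂ N) z≈x z∈N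
      where
      z≈x : z W.≈ x
      z≈x = W.trans (W.sym (identity z))
           (W.trans (▷-cong (G.sym (G.inverseˡ g)) W.refl)
           (W.trans (assoc _ _ _)
           (W.trans (▷-cong G.refl gz≈y) g⁻¹y≈x)))

  translate-⊆ⁿ : ∀ g {A B} → A ⊆ⁿ B → (g · A) ⊆ⁿ (g · B)
  translate-⊆ⁿ g A⊆B = null-⊆
    (λ { ((y , y∈A , gy≈x) , x∉gB) → y , (y∈A , λ y∈B → x∉gB (y , y∈B , gy≈x)) , gy≈x })
    (translate-null g A⊆B)

  cell-respects : ∀ {c d} → c Cell.≈ d → cell c ⊆ cell d
  cell-respects (g≈h , refl) (y , y∈K , gy≈x) =
    y , y∈K , W.trans (▷-cong (G.sym g≈h) W.refl) gy≈x

  cell-borel : ∀ c → Borel τ (cell c)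
  cell-borel (h , k) = Borel-image τ (homeo h) (proj₂ (Tile.borelSet (𝒦 k)))

  ¬null-cell : ∀ c → ¬ Null μ (cell c)
  ¬null-cell (h , k) = positive⇒¬null (cell (h , k) , cell-borel (h , k))
    (preserving h (Tile.borelSet (𝒦 k)) (Tile.positive (𝒦 k)))

  region : Pred Cell ℓ → Pred W.Carrier ℓ
  region S = ⋃ (Σ Cell S) (cell ∘ proj₁)

  region-⊆ : ∀ {S S′} → S ⊆ S′ → region S ⊆ region S′
  region-⊆ S⊆S′ ((c , c∈S) , x∈c) = (c , S⊆S′ c∈S) , x∈c

  cell⊆region : ∀ {S c} → c ∈ S → cell c ⊆ region S
  cell⊆region {c = c} c∈S x∈c = (c , c∈S) , x∈c

  -- S is countable only up to Cell.≈, so the union is regrouped over the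
  -- representatives of G and over Fin n, in two stages to avoid a pairing function.
  null-∩-region : ∀ {A : Pred W.Carrier ℓ} {S} →
                  (∀ {c} → c ∈ S → Null μ (A ∩ cell c)) → Null μ (A ∩ region S)
  null-∩-region {A} {S} null = null-cover G-countable.code
    (λ { (x∈A , (((h , k) , c∈S) , x∈c)) → let (j , j≈h) = G-countable.exhaust {h} _ in
      j , k , x∈A , (h , k) , c∈S , (G.sym j≈h , refl) , x∈c })
    (λ j → null-cover (mk↣ Fin.toℕ-injective) id (λ k → null-at (G-countable.elt j , k)))
    where
    at : Cell → Pred W.Carrier ℓ
    at d x = x ∈ A × ∃ λ c → c ∈ S × c Cell.≈ d × x ∈ cell c
    null-at : ∀ d → Null μ (at d)
    null-at d with em {P = ∃ λ c → c ∈ S × c Cell.≈ d}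
    ... | no ∄c = null-empty λ { (_ , c , c∈S , c≈d , _) → ∄c (c , c∈S , c≈d) }
    ... | yes (c , c∈S , c≈d) = null-⊆
      (λ { (x∈A , c′ , _ , c′≈d , x∈c′) →
           x∈A , cell-respects (Cell.trans c′≈d (Cell.sym c≈d)) x∈c′ })
      (null c∈S)

  -- Saturation makes `c` inequivalent to every member of `S`, so disjointness of the grid applies
  -- cell by cell.
  null-cell-∩-region : ∀ {S c} → S Respects Cell._≈_ → c ∉ S → Null μ (cell c ∩ region S)
  null-cell-∩-region {c = c} S-resp c∉S = null-∩-region λ {d} d∈S →
    proj₁ grid c d λ c≈d → c∉S (S-resp (Cell.sym c≈d) d∈S)

  -- The cells of S are recovered from its region, since c ∉ S would make the cell of c
  -- null.
  cell⊆ⁿregion : ∀ {S c} → S Respects Cell._≈_ → cell c ⊆ⁿ region S → c ∈ S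
  cell⊆ⁿregion {c = c} S-resp c⊆S = dne λ c∉S → ¬null-cell c
    (null-⊆ (λ x∈c → x∈c , x∈c)
      (null-⊆ⁿ (⊆ⁿ-∩ (⊆⇒⊆ⁿ {cell c} id) c⊆S) (null-cell-∩-region S-resp c∉S)))

  null-region-∩ : ∀ {S S′} → S′ Respects Cell._≈_ → Empty (S ∩ S′) →
                  Null μ (region S ∩ region S′)
  null-region-∩ S′-resp disjoint = null-⊆ (λ (x∈S , x∈S′) → x∈S′ , x∈S)
    (null-∩-region λ {c} c∈S → null-⊆ (λ (x∈S′ , x∈c) → x∈c , x∈S′)
      (null-cell-∩-region S′-resp λ c∈S′ → disjoint c (c∈S , c∈S′)))

  -- Translated regions and transfer of partitions.

  translate-region : ∀ g {S} → g · region S ≐ region (g ·ᵗ S)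
  translate-region g =
    (λ { (y , (((h , k) , c∈S) , z , z∈K , hz≈y) , gy≈x) →
         ((g G.∙ h , k) , (h , k) , c∈S , Cell.refl) , z , z∈K ,
         W.trans (assoc g h z) (W.trans (▷-cong G.refl hz≈y) gy≈x) }) ,
    (λ { ((d , (h , k) , c∈S , gc≈d) , x∈d) →
         let (z , z∈K , ghz≈x) = cell-respects (Cell.sym gc≈d) x∈d in
         h ▷ z , (((h , k) , c∈S) , z , z∈K , W.refl) , W.trans (W.sym (assoc g h z)) ghz≈x })

  ·ᵗ-respects : ∀ g S → (g ·ᵗ S) Respects Cell._≈_
  ·ᵗ-respects g S d≈e (c , c∈S , gc≈d) = c , c∈S , Cell.trans gc≈d d≈e

  -- The code of `I` ensures that replacing every `A i` by `region (S i)` changes the union by a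
  -- null set only.
  ≡⨆⇔≡⨆ᴳ : ∀ {I : Set ℓ} → I ↣ ℕ → ∀ {A S} → (∀ i → S i Respects Cell._≈_) →
            (∀ i → A i ≡ⁿ region (S i)) →
            (Whole ≡⨆[ setoid I ] A) ⇔ (Whole ∅ᴳ.≡⨆[ setoid I ] S)
  ≡⨆⇔≡⨆ᴳ {I} code {A} {S} S-resp A≡S = mk⇔ to from
    where
    to : Whole ≡⨆[ setoid I ] A → Whole ∅ᴳ.≡⨆[ setoid I ] S
    to (disjoint , whole) =
      -- The cell of a common element `c` would lie, up to a null set, in the null set `A i ∩ A j`.
      (λ i j i≢j c (c∈Sᵢ , c∈Sⱼ) → ¬null-cell c
        (null-⊆ (λ x∈c → cell⊆region c∈Sᵢ x∈c , cell⊆region c∈Sⱼ x∈c)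
          (null-⊆ⁿ (⊆ⁿ-∩ (≡ⁿ⇒⊇ⁿ (A≡S i)) (≡ⁿ⇒⊇ⁿ (A≡S j))) (disjoint i j i≢j)))) ,
      -- The cell of `c` lies in the whole space, hence up to a null set in the region of the union
      -- of the `S i`, which forces `c` into that union.
      λ { c (inj₁ (_ , c∉S)) → c∉S (cell⊆ⁿregion
            (λ { c≈d (i , c∈Sᵢ) → i , S-resp i c≈d c∈Sᵢ })
            (⊆ⁿ-trans (⊆⇒⊆ⁿ {B = Whole} _)
            (⊆ⁿ-trans (≡ⁿ⇒⊆ⁿ whole)
            (⊆ⁿ-trans (⊆ⁿ-⋃ code (≡ⁿ⇒⊆ⁿ ∘ A≡S))
              (⊆⇒⊆ⁿ λ { (i , (c , c∈Sᵢ) , x∈c) → (c , i , c∈Sᵢ) , x∈c })))))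
        ; c (inj₂ (c∉Whole , _)) → c∉Whole _ }
    from : Whole ∅ᴳ.≡⨆[ setoid I ] S → Whole ≡⨆[ setoid I ] A
    from (disjoint , whole) =
      (λ i j i≢j → null-⊆ⁿ (⊆ⁿ-∩ (≡ⁿ⇒⊆ⁿ (A≡S i)) (≡ⁿ⇒⊆ⁿ (A≡S j)))
        (null-region-∩ (S-resp j) (disjoint i j i≢j))) ,
      ⊆ⁿ-antisym
        (⊆ⁿ-trans (≡ⁿ⇒⊆ⁿ (proj₂ grid))
        (⊆ⁿ-trans
          -- The covering only says that no `c` escapes all the `S i`; double negation elimination
          -- extracts an index.
          (⊆⇒⊆ⁿ λ { (c , x∈c) →
            let (i , c∈Sᵢ) = dne (λ c∉S → whole c (inj₁ (_ , c∉S))) in i , (c , c∈Sᵢ) , x∈c })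
          (⊆ⁿ-⋃ code (≡ⁿ⇒⊇ⁿ ∘ A≡S))))
        (⊆⇒⊆ⁿ _)

  -- The bijection between poly-tiles and finite tiles.

  elements-respects : ∀ cs → elements cs Respects Cell._≈_
  elements-respects cs = ∈-resp-≈ G×𝒦

  set≡region : ∀ T → PolyTile.set T ≡ⁿ region (elements (Ψ T))
  set≡region T = proj₂ (PolyTile.decompose T)

  borel-region : ∀ cs → Borel τ (region (elements cs))
  borel-region []       = resp-≐ ((λ ()) , λ { ((_ , ()) , _) }) borel-∅
  borel-region (c ∷ cs) = resp-≐
    ((λ { (inj₁ x∈c) → (c , here Cell.refl) , x∈c
        ; (inj₂ x∈cs) → region-⊆ there x∈cs }) ,
     (λ { ((d , here d≈c) , x∈d) → inj₁ (cell-respects d≈c x∈d)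
        ; ((d , there d∈cs) , x∈d) → inj₂ ((d , d∈cs) , x∈d) }))
    (borel-∪ (cell-borel c) (borel-region cs))

  -- An empty decomposition would make the tile null, against its positive measure.
  Ψ-nonempty : ∀ T → Satisfiable (elements (Ψ T))
  Ψ-nonempty T = nonempty (Ψ T) (≡ⁿ⇒⊆ⁿ (set≡region T))
    where
    nonempty : ∀ cs → PolyTile.set T ⊆ⁿ region (elements cs) → Satisfiable (elements cs)
    nonempty []       T⊆∅ = contradiction
      (null-⊆ⁿ T⊆∅ (null-empty λ { ((_ , ()) , _) }))
      (positive⇒¬null (Tile.borelSet (PolyTile.tile T)) (Tile.positive (PolyTile.tile T)))
    nonempty (c ∷ cs) _   = c , here Cell.refl

  private
    Φ = Ψᶠ Ψ-nonempty

  -- Each cell of `Ψ T` lies, up to a null set, in `T′` and so in the region of `Ψ T′`. Only the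
  -- underlying sets are compared, so `Ψ` is also independent of the chosen decomposition.
  Ψ-mono : ∀ {T T′} → PolyTile.set T ⊆ⁿ PolyTile.set T′ → elements (Ψ T) ⊆ elements (Ψ T′)
  Ψ-mono {T} {T′} T⊆T′ c∈ΨT = cell⊆ⁿregion (elements-respects (Ψ T′))
    (⊆ⁿ-trans (⊆⇒⊆ⁿ (cell⊆region c∈ΨT))
    (⊆ⁿ-trans (≡ⁿ⇒⊇ⁿ (set≡region T))
    (⊆ⁿ-trans T⊆T′ (≡ⁿ⇒⊆ⁿ (set≡region T′)))))

  Ψ-cong : ∀ {T T′} → T ≈ᵖ T′ → Φ T ≈ᶠ Φ T′
  Ψ-cong {T} {T′} T≡T′ = Ψ-mono {T} {T′} (≡ⁿ⇒⊆ⁿ T≡T′) , Ψ-mono {T′} {T} (≡ⁿ⇒⊇ⁿ T≡T′)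

  Ψ-injective : ∀ {T T′} → Φ T ≈ᶠ Φ T′ → T ≈ᵖ T′
  Ψ-injective {T} {T′} (Ψ⊆ , Ψ⊇) = ⊆ⁿ-antisym (reflects {T} {T′} Ψ⊆) (reflects {T′} {T} Ψ⊇)
    where
    reflects : ∀ {T T′} → elements (Ψ T) ⊆ elements (Ψ T′) → PolyTile.set T ⊆ⁿ PolyTile.set T′
    reflects {T} {T′} Ψ⊆ =
      ⊆ⁿ-trans (≡ⁿ⇒⊆ⁿ (set≡region T))
      (⊆ⁿ-trans (⊆⇒⊆ⁿ (region-⊆ Ψ⊆)) (≡ⁿ⇒⊇ⁿ (set≡region T′)))

  -- Inverse of `Ψ`: the region of the list, positive because it contains a cell that is not null.
  polyTile : FiniteTile → PolyTile
  polyTile (cs , c , c∈cs) = record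
    { tile = record
      { borelSet = B
      ; positive = ¬null⇒positive B λ B-null → ¬null-cell c (null-⊆ (cell⊆region c∈cs) B-null)
      }
    ; Ψ         = cs
    ; decompose = (λ { (c , _) (d , _) → proj₁ grid c d }) , IsEquivalence.refl ≡ⁿ-isEquivalence
    }
    where
    B : BorelSet τ
    B = region (elements cs) , borel-region cs

  Ψ-bijection : IsBijection _≈ᵖ_ _≈ᶠ_ Φ
  Ψ-bijection = record
    { isInjection = record
      { isCongruent = record
        { cong           = λ {T} {T′} → Ψ-cong {T} {T′}
        ; isEquivalence₁ = On.isEquivalence PolyTile.set ≡ⁿ-isEquivalence
        ; isEquivalence₂ = record
          { refl  = id , id
          ; sym   = λ (c⊆d , d⊆c) → d⊆c , c⊆d
          ; trans = λ {F} {F′} {F″} → ≈ᶠ-trans {F} {F′} {F″}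
          }
        }
      ; injective = λ {T} {T′} → Ψ-injective {T} {T′}
      }
    -- `Ψ (polyTile F)` is the list of `F` by definition, so congruence settles every `T` equivalent
    -- to `polyTile F`.
    ; surjective = λ F → polyTile F , λ {T} → Ψ-cong {T} {polyTile F}
    }

  -- Stated up to `≈ᵍᶠ` because a representative chosen in `G × 𝒦` is only equivalent to a renamed
  -- pair.
  translate-tile : ∀ {g g′ T F} → (g , Φ T) ≈ᵍᶠ (g′ , F) →
                   g · PolyTile.set T ≡ⁿ region (g′ ·ᵗ elements (proj₁ F))
  translate-tile {g} {g′} {T} (g≈g′ , Ψ⊆F , F⊆Ψ) = ⊆ⁿ-antisym
    (⊆ⁿ-trans (translate-⊆ⁿ g (≡ⁿ⇒⊆ⁿ (set≡region T)))
      (⊆⇒⊆ⁿ (region-⊆ (λ { (c , c∈Ψ , gc≈d) → c , Ψ⊆F c∈Ψ ,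
          Cell.trans (G.∙-cong (G.sym g≈g′) G.refl , refl) gc≈d })
        ∘ proj₁ (translate-region g))))
    (⊆ⁿ-trans
      (⊆⇒⊆ⁿ (proj₂ (translate-region g) ∘ region-⊆ (λ { (c , c∈F , g′c≈d) → c , F⊆Ψ c∈F ,
          Cell.trans (G.∙-cong g≈g′ G.refl , refl) g′c≈d })))
      (translate-⊆ⁿ g (≡ⁿ⇒⊇ⁿ (set≡region T))))

  -- Transfer of cotilers in both directions.

  module _ (𝒯 : PolyTileSet) (C : PolyPairSet) (C⊆𝒯 : Member C ⊆ (proj₂ ⊢ Member 𝒯)) where

    -- The index type and code are kept; injectivity of `Ψ` keeps the renamed representatives
    -- distinct, and congruence keeps them exhaustive.
    rename-cotiler : IsCotilerᵂ 𝒯 C → IsCotilerᴳ (Ψ-set Ψ-nonempty 𝒯) (rename Ψ-nonempty C)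
    rename-cotiler cotiler = record
      { subset    = λ { ((_ , T) , gT∈C , _ , ΨT≈F) → T , C⊆𝒯 gT∈C , ΨT≈F }
      ; countable = record
        { Index    = Index
        ; code     = code
        ; elt      = map₂ Φ ∘ elt
        ; elt∈     = λ j → elt j , elt∈ j , G.refl , id , id
        ; distinct = λ { {i} {j} (g≈ , Ψ≈) →
            distinct (g≈ , Ψ-injective {proj₂ (elt i)} {proj₂ (elt j)} Ψ≈) }
        ; exhaust  = λ { {_ , F} ((g , T) , gT∈C , g≈ , ΨT≈F) →
            let (j , gⱼ≈g , Tⱼ≈T) = exhaust gT∈C ; Tⱼ = proj₂ (elt j) in
            j , G.trans gⱼ≈g g≈ ,
            ≈ᶠ-trans {Φ Tⱼ} {Φ T} {F} (Ψ-cong {Tⱼ} {T} Tⱼ≈T) ΨT≈F }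
        }
      ; covers = Equivalence.to (≡⨆⇔≡⨆ᴳ code (λ j → ·ᵗ-respects _ _)
          (λ j → translate-tile {T = proj₂ (elt j)} {Φ (proj₂ (elt j))} (G.refl , id , id)))
          covers
      }
      where
      open IsCotiler cotiler
      open Countable countable

    -- Membership of each representative in the image supplies a pair of `C` that renames to it up
    -- to equivalence; these pairs represent the classes of `C`.
    unrename-cotiler : IsCotilerᴳ (Ψ-set Ψ-nonempty 𝒯) (rename Ψ-nonempty C) → IsCotilerᵂ 𝒯 C
    unrename-cotiler cotiler = record
      { subset    = C⊆𝒯
      ; countable = record
        { Index    = Index
        ; code     = code
        ; elt      = proj₁ ∘ elt∈
        ; elt∈     = proj₁ ∘ proj₂ ∘ elt∈
        ; distinct = λ { {i} {j} (g≈ , T≈) → distinct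
            (≈ᵍᶠ-trans {elt i} {original i} {elt j} (≈ᵍᶠ-sym {original i} {elt i} (original≈ i))
              (≈ᵍᶠ-trans {original i} {original j} {elt j}
                (g≈ , Ψ-cong {proj₂ (proj₁ (elt∈ i))} {proj₂ (proj₁ (elt∈ j))} T≈)
                (original≈ j))) }
        ; exhaust  = λ { {g , T} gT∈C →
            let (j , eltⱼ≈) = exhaust {g , Φ T} ((g , T) , gT∈C , G.refl , id , id)
                (g≈ , Ψ≈)   = ≈ᵍᶠ-trans {original j} {elt j} {g , Φ T} (original≈ j) eltⱼ≈
            in j , g≈ , Ψ-injective {proj₂ (proj₁ (elt∈ j))} {T} Ψ≈ }
        }
      ; covers = Equivalence.from (≡⨆⇔≡⨆ᴳ code (λ j → ·ᵗ-respects _ _)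
          (λ j → translate-tile {T = proj₂ (proj₁ (elt∈ j))} {proj₂ (elt j)} (original≈ j)))
          covers
      }
      where
      open IsCotiler cotiler
      open Countable countable

      original : Index → G.Carrier × FiniteTile
      original = map₂ Φ ∘ proj₁ ∘ elt∈

      original≈ : ∀ j → original j ≈ᵍᶠ elt j
      original≈ = proj₂ ∘ proj₂ ∘ elt∈

      ≈ᵍᶠ-sym : ∀ {p q} → p ≈ᵍᶠ q → q ≈ᵍᶠ p
      ≈ᵍᶠ-sym (g≈ , F⊆F′ , F′⊆F) = G.sym g≈ , F′⊆F , F⊆F′

theorem7 : (∀ {a} → ExcludedMiddle a) →
    ∀ {ℓ : Level} (G : Group ℓ ℓ) (W : Setoid ℓ ℓ) (τ : Topology W) (μ : BorelMeasure τ) →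
    Nontrivial μ →
    (α : Action G W) (homeo : ByHomeomorphisms μ α) → NegligibilityPreserving μ α homeo →
    Countable ℓ (Group._≈_ G) (U {A = Group.Carrier G}) →
    ∀ {n : ℕ} (𝒦 : Fin n → Tile μ) →
    Injective _≡_ (λ S T → Tile.set S ≐ Tile.set T) 𝒦 →
    let open Poly μ α 𝒦 in
    YieldsGrid →
    Σ (∀ T → Satisfiable (elements (Ψ T))) λ Ψ-nonempty →
    IsBijection _≈ᵖ_ _≈ᶠ_ (Ψᶠ Ψ-nonempty) ×
    IsBijection _≐ᶜ_ _≐ᶜ_ (Ψ-set Ψ-nonempty) ×
    (∀ (𝒯 : PolyTileSet) (C : PolyPairSet) →
    Member C ⊆ (proj₂ ⊢ Member 𝒯) →
    Countable ℓ (Pointwise (Group._≈_ G) _≈ᵖ_) (Member C) →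
    IsCotilerᵂ 𝒯 C ⇔ IsCotilerᴳ (Ψ-set Ψ-nonempty 𝒯) (rename Ψ-nonempty C))
theorem7 em {ℓ} G W τ μ _ α homeo preserving G-countable 𝒦 _ grid =
  Ψ-nonempty ,
  Ψ-bijection ,
  image-bijection (Level.suc ℓ) Ψ-bijection (λ {F} {F′} {F″} → ≈ᶠ-trans {F} {F′} {F″}) ,
  λ 𝒯 C C⊆𝒯 _ → mk⇔ (rename-cotiler 𝒯 C C⊆𝒯) (unrename-cotiler 𝒯 C C⊆𝒯)
  where
  open Poly μ α 𝒦
  open Grid em μ α homeo preserving G-countable 𝒦 grid
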